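{- Let $S$ be a star with central vertex $c$, let $\lambda$ be a 1-labeling of $S$, and let $X$ be a maximum-size set of leaves of $S$ such that $\lambda(cu)\neq\lambda(cv)$ for all distinct $u,v\in X$. Then the set $V(S)\setminus X$ is a minimum-size temporal resolving set of the temporal graph $(S,\lambda)$.
   Context: A temporal graph $(G,\lambda)$ consists of a finite simple undirected graph $G=(V,E)$ (the underlying graph) and a time labeling $\lambda$ assigning to each edge $e\in E$ a nonempty finite set $\lambda(e)$ of positive integers (the time-steps at which $e$ is present). $\lambda$ is a 1-labeling if $|\lambda(e)|\le 1$ (hence $=1$) for every edge. A journey from $u$ to $v$ is a path in the underlying graph from $u$ to $v$ together with a choice, for each edge of the path, of a time-step in its label set so that the chosen time-steps are strictly increasing along the path. The temporal distance $\mathrm{dist}_t(u,v)$ is the smallest time-step at which a journey from $u$ reaches $v$ (with $\mathrm{dist}_t(u,u)=0$, and $\mathrm{dist}_t(u,v)=\infty$ if there is no journey from $u$ to $v$). A vertex $v$ is reachable from $u$ if there is a journey from $u$ to $v$ (every vertex is reachable from itself). A set $R\subseteq V$ is a temporal resolving set if (i) every $v\in V$ is reachable from some $s\in R$, and (ii) for every two distinct $u,v\in V$ there is $s\in R$ with $\mathrm{dist}_t(s,u)\neq \mathrm{dist}_t(s,v)$. -}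

module Defs where

open import Data.Fin.Base using (Fin)
open import Data.Fin.Subset using (Subset; _∈_; ∣_∣)
open import Data.List.Base using (List; []; _∷_; [_]; last; length)
open import Data.List.Membership.Propositional using () renaming (_∈_ to _∈ˡ_)
open import Data.List.Relation.Unary.All using (All)
open import Data.List.Relation.Unary.Linked using (Linked)
open import Data.List.Relation.Unary.Unique.Propositional using (Unique)
open import Data.Maybe.Base using (Maybe; just; nothing; fromMaybe)
open import Data.Nat.Base using (ℕ; _≤_; _<_)
open import Data.Product.Base using (∃-syntax; _×_)
open import Data.Sum.Base using (_⊎_)
open import Level using (0ℓ)
open import Relation.Binary.Core using (Rel)
open import Relation.Binary.Definitions using (Symmetric; Irreflexive; Decidable)
open import Relation.Binary.PropositionalEquality using (_≡_; _≢_)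
open import Relation.Nullary.Negation using (¬_)

record Graph (n : ℕ) : Set₁ where
  field
    Adj    : Rel (Fin n) 0ℓ
    sym    : Symmetric Adj
    irrefl : Irreflexive _≡_ Adj
    adj?   : Decidable Adj

-- A finite set of time-steps is represented by its strictly increasing
-- enumeration, so that equality of sets is _≡_ and cardinality is length.
-- The adjacency proof is irrelevant and the labels are symmetric, hence they
-- depend only on the undirected edge.
record TimeLabeling {n : ℕ} (G : Graph n) : Set where
  open Graph G
  field
    times     : ∀ {u v} → .(Adj u v) → List ℕ
    symmetric : ∀ {u v} (e : Adj u v) → times (sym e) ≡ times e
    sorted    : ∀ {u v} (e : Adj u v) → Linked _<_ (times e)
    nonempty  : ∀ {u v} (e : Adj u v) → times e ≢ []
    positive  : ∀ {u v} (e : Adj u v) → All (0 <_) (times e)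

module _ {n : ℕ} {G : Graph n} (Λ : TimeLabeling G) where
  open Graph G
  open TimeLabeling Λ

  IsOneLabeling : Set
  IsOneLabeling = ∀ {u v} (e : Adj u v) → length (times e) ≤ 1

  data TimedWalk : Fin n → Fin n → Set where
    stop : ∀ {u} → TimedWalk u u
    step : ∀ {u w v} (e : Adj u w) (t : ℕ) → t ∈ˡ times e →
           TimedWalk w v → TimedWalk u v

  vertices : ∀ {u v} → TimedWalk u v → List (Fin n)
  vertices {u} stop           = [ u ]
  vertices {u} (step _ _ _ p) = u ∷ vertices p

  timeSteps : ∀ {u v} → TimedWalk u v → List ℕ
  timeSteps stop           = []
  timeSteps (step _ t _ p) = t ∷ timeSteps p

  record Journey (u v : Fin n) : Set where
    field
      walk       : TimedWalk u v
      isPath     : Unique (vertices walk)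
      increasing : Linked _<_ (timeSteps walk)

  -- The only journey from a vertex to itself has no edges; it arrives at
  -- time 0, which yields the convention dist(u,u) = 0.
  arrival : ∀ {u v} → Journey u v → ℕ
  arrival J = fromMaybe 0 (last (timeSteps (Journey.walk J)))

  -- IsDist u v d means dist(u,v) = d, with nothing standing for ∞. The distance
  -- always exists, since journeys in a finite graph can be searched exhaustively.
  data IsDist (u v : Fin n) : Maybe ℕ → Set where
    finite   : ∀ {t} (J : Journey u v) → arrival J ≡ t →
               (∀ (J′ : Journey u v) → t ≤ arrival J′) → IsDist u v (just t)
    infinite : ¬ Journey u v → IsDist u v nothing

  -- dist(s,u) ≠ dist(s,v)
  Resolves : Fin n → Fin n → Fin n → Set
  Resolves s u v = ∃[ d ] ∃[ d′ ] (IsDist s u d × IsDist s v d′ × d ≢ d′)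

  record IsTemporalResolving (R : Subset n) : Set where
    field
      reaches  : ∀ v → ∃[ s ] (s ∈ R × Journey s v)
      resolves : ∀ {u v} → u ≢ v → ∃[ s ] (s ∈ R × Resolves s u v)

record IsStar {n : ℕ} (G : Graph n) (c : Fin n) : Set where
  open Graph G
  field
    spoke    : ∀ {u} → u ≢ c → Adj c u
    incident : ∀ {u v} → Adj u v → u ≡ c ⊎ v ≡ c

-- The leaves of a star are its non-central vertices; in K₂ the chosen centre,
-- though of degree one, is not a leaf.
record IsDistinctlyLabelledLeafSet {n : ℕ} {S : Graph n} {c : Fin n}
         (star : IsStar S c) (Λ : TimeLabeling S) (X : Subset n) : Set where
  open IsStar star
  open TimeLabeling Λ
  field
    leaf     : ∀ {u} → u ∈ X → u ≢ c
    distinct : ∀ {u v} (u∈X : u ∈ X) (v∈X : v ∈ X) → u ≢ v →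
               times (spoke (leaf u∈X)) ≢ times (spoke (leaf v∈X))

IsMaximumSize IsMinimumSize : ∀ {n} → (Subset n → Set) → Subset n → Set
IsMaximumSize P X = P X × (∀ Y → P Y → ∣ Y ∣ ≤ ∣ X ∣)
IsMinimumSize P X = P X × (∀ Y → P Y → ∣ X ∣ ≤ ∣ Y ∣)

{-# OPTIONS --safe #-}
-- A journey ending at a leaf v uses the edge cv last, so it arrives at time
-- λ(cv); with the convention λ(cc) = 0, a vertex s ≠ v reaches v exactly when
-- λ(cs) < λ(cv). Hence two leaves with equal labels are resolved only by
-- themselves, whereas c resolves leaves with distinct labels.
--
-- Lower bound: if a resolving set R contains c, then its complement is a set of
-- distinctly labelled leaves. If it does not, let s ∈ R have minimum label: each
-- leaf outside R is reached from R, so its label exceeds that of s. Exchanging s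
-- for c therefore keeps the leaves outside R distinctly labelled.
module Submission where

open import Data.Fin.Base using (Fin)
open import Data.Fin.Properties using (_≟_)
open import Data.Fin.Subset using (Subset; inside; outside; _∈_; _∉_; ∣_∣; ∁; _∪_; _-_; ⁅_⁆)
open import Data.Fin.Subset.Properties
  using (_∈?_; ∣p∣≤n; ∣∁p∣≡n∸∣p∣; ∣⁅x⁆∣≡1; x∈⁅x⁆; x∈p∪q⁺; x∈p∧x≢y⇒x∈p-y;
         x∈p⇒∣p-x∣<∣p∣; x∈∁p⇒x∉p; x∉p⇒x∈∁p)
open import Data.List.Base using (List; []; _∷_; [_]; head; last; length; filter; allFin)
open import Data.List.Extrema.Nat using (argmin; argmin-all; f[argmin]≤f[xs])
open import Data.List.Membership.Propositional using () renaming (_∈_ to _∈ˡ_)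
open import Data.List.Membership.Propositional.Properties using (∈-filter⁺; ∈-allFin)
open import Data.List.Relation.Unary.All using ([]; _∷_; lookup)
open import Data.List.Relation.Unary.All.Properties using (all-filter)
open import Data.List.Relation.Unary.Any using (here)
open import Data.List.Relation.Unary.AllPairs using ([]; _∷_)
open import Data.List.Relation.Unary.Linked using (Linked; []; [-]; _∷_; tail)
open import Data.Maybe.Base using (just; nothing; fromMaybe)
open import Data.Maybe.Properties using (just-injective)
open import Data.Nat.Base using (ℕ; _≤_; _<_; _+_; _∸_; z≤n; s≤s)
open import Data.Nat.Properties
  using (_<?_; ≤-reflexive; ≤-trans; <-irrefl; <⇒≢; ≤-<-trans; m≤n⇒m≤1+n; +-suc; +-comm;
         ∸-monoʳ-≤; m∸[m∸n]≡n; module ≤-Reasoning)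
open import Data.Product.Base using (∃-syntax; _×_; _,_; proj₁; proj₂)
open import Data.Sum.Base using (_⊎_; inj₁; inj₂)
open import Data.Vec.Base using ([]; _∷_)
open import Function.Base using (_∘_)
open import Relation.Binary.PropositionalEquality
  using (_≡_; _≢_; refl; sym; trans; cong; subst; ≢-sym)
open import Relation.Nullary.Decidable using (yes; no)
open import Relation.Nullary.Negation using (¬_; contradiction)
open import Defs

-- Finite subsets: cardinality, exchange and minimisers.

∣p∪q∣≤∣p∣+∣q∣ : ∀ {n} (p q : Subset n) → ∣ p ∪ q ∣ ≤ ∣ p ∣ + ∣ q ∣
∣p∪q∣≤∣p∣+∣q∣ []            []            = z≤n
∣p∪q∣≤∣p∣+∣q∣ (outside ∷ p) (outside ∷ q) = ∣p∪q∣≤∣p∣+∣q∣ p q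
∣p∪q∣≤∣p∣+∣q∣ (outside ∷ p) (inside ∷ q)
  rewrite +-suc ∣ p ∣ ∣ q ∣ = s≤s (∣p∪q∣≤∣p∣+∣q∣ p q)
∣p∪q∣≤∣p∣+∣q∣ (inside ∷ p)  (outside ∷ q) = s≤s (∣p∪q∣≤∣p∣+∣q∣ p q)
∣p∪q∣≤∣p∣+∣q∣ (inside ∷ p)  (inside ∷ q)
  rewrite +-suc ∣ p ∣ ∣ q ∣ = s≤s (m≤n⇒m≤1+n (∣p∪q∣≤∣p∣+∣q∣ p q))

-- Subtraction from `n` reverses the inequality. This turns the maximality of `X`, tested on the
-- complement of a set, into a lower bound on that set.
∣∁p∣≤∣q∣⇒∣∁q∣≤∣p∣ : ∀ {n} (p q : Subset n) → ∣ ∁ p ∣ ≤ ∣ q ∣ → ∣ ∁ q ∣ ≤ ∣ p ∣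
∣∁p∣≤∣q∣⇒∣∁q∣≤∣p∣ {n} p q ∣∁p∣≤∣q∣ = begin
  ∣ ∁ q ∣           ≡⟨ ∣∁p∣≡n∸∣p∣ q ⟩
  n ∸ ∣ q ∣         ≤⟨ ∸-monoʳ-≤ n ∣∁p∣≤∣q∣ ⟩
  n ∸ ∣ ∁ p ∣       ≡⟨ cong (n ∸_) (∣∁p∣≡n∸∣p∣ p) ⟩
  n ∸ (n ∸ ∣ p ∣)   ≡⟨ m∸[m∸n]≡n (∣p∣≤n p) ⟩
  ∣ p ∣             ∎
  where open ≤-Reasoning

exchange : ∀ {n} → Subset n → Fin n → Fin n → Subset n
exchange p x y = (p - x) ∪ ⁅ y ⁆

∣exchange∣≤ : ∀ {n} (p : Subset n) {x} y → x ∈ p → ∣ exchange p x y ∣ ≤ ∣ p ∣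
∣exchange∣≤ p {x} y x∈p = begin
  ∣ exchange p x y ∣        ≤⟨ ∣p∪q∣≤∣p∣+∣q∣ (p - x) ⁅ y ⁆ ⟩
  ∣ p - x ∣ + ∣ ⁅ y ⁆ ∣     ≡⟨ cong (∣ p - x ∣ +_) (∣⁅x⁆∣≡1 y) ⟩
  ∣ p - x ∣ + 1             ≡⟨ +-comm ∣ p - x ∣ 1 ⟩
  1 + ∣ p - x ∣             ≤⟨ x∈p⇒∣p-x∣<∣p∣ x∈p ⟩
  ∣ p ∣                     ∎
  where open ≤-Reasoning

∉exchange : ∀ {n} (p : Subset n) {x y z} → z ∉ exchange p x y → z ≡ x ⊎ z ∉ p
∉exchange p {x} {y} {z} z∉ with z ≟ x
... | yes z≡x = inj₁ z≡x
... | no  z≢x = inj₂ λ z∈p → z∉ (x∈p∪q⁺ (inj₁ (x∈p∧x≢y⇒x∈p-y z∈p z≢x)))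

minimiser : ∀ {n} (f : Fin n → ℕ) (p : Subset n) {x} → x ∈ p →
            ∃[ m ] (m ∈ p × (∀ {y} → y ∈ p → f m ≤ f y))
minimiser {n} f p {x} x∈p =
  -- The default `x` of `argmin` lies in `p`, so the minimiser lies in `p` whether it is the default
  -- or a list entry.
  argmin f x elements ,
  argmin-all f x∈p (all-filter (_∈? p) (allFin n)) ,
  λ {y} y∈p → lookup (f[argmin]≤f[xs] x elements) (∈-filter⁺ (_∈? p) (∈-allFin y) y∈p)
  where
  elements : List (Fin n)
  elements = filter (_∈? p) (allFin n)

-- Lists with a single entry.

singleton-head : (ts : List ℕ) → length ts ≤ 1 → ts ≢ [] → ts ≡ [ fromMaybe 0 (head ts) ]
singleton-head []          _        ts≢[] = contradiction refl ts≢[]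
singleton-head (_ ∷ [])    _        _     = refl
singleton-head (_ ∷ _ ∷ _) (s≤s ()) _

∈-singleton : ∀ {t l} {ts : List ℕ} → ts ≡ [ l ] → t ∈ˡ ts → t ≡ l
∈-singleton refl (here t≡l) = t≡l

singleton-∈ : ∀ {l} {ts : List ℕ} → ts ≡ [ l ] → l ∈ˡ ts
singleton-∈ refl = here refl

-- Meant for a journey that enters the centre at time `t` and leaves it by one last edge at time
-- `l`.
linked-last : ∀ {t l ts} → ts ≡ [ l ] → Linked _<_ (t ∷ ts) →
              t < l × last (t ∷ ts) ≡ just l
linked-last refl (t<l ∷ _) = t<l , refl

-- Labels of the spokes.

module OneLabelledStar {n : ℕ} {S : Graph n} {c : Fin n} (star : IsStar S c)
                       (Λ : TimeLabeling S) (oneLabeling : IsOneLabeling Λ) where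
  open Graph S using (Adj; irrefl) renaming (sym to adj-sym)
  open TimeLabeling Λ
  open IsStar star
  open Journey

  -- Opaque, so that case distinctions on s ≟ c do not abstract inside label s.
  opaque
    label : Fin n → ℕ
    label u with u ≟ c
    ... | yes _   = 0
    ... | no  u≢c = fromMaybe 0 (head (times (spoke u≢c)))

    label-centre : label c ≡ 0
    label-centre with c ≟ c
    ... | yes _   = refl
    ... | no  c≢c = contradiction refl c≢c

    times-from-centre : ∀ {u} (e : Adj c u) → times e ≡ [ label u ]
    times-from-centre {u} e with u ≟ c
    ... | yes u≡c = contradiction e (irrefl (sym u≡c))
    -- Adjacency proofs are irrelevant, so `times e` and `times (spoke u≢c)` agree definitionally.
    ... | no  u≢c = singleton-head (times e) (oneLabeling e) (nonempty e)

  times-to-centre : ∀ {u} (e : Adj u c) → times e ≡ [ label u ]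
  times-to-centre e = trans (sym (symmetric e)) (times-from-centre (adj-sym e))

  -- Puts the centre, with label 0, strictly below every leaf, and keeps arrival times at leaves
  -- apart from the distance 0.
  label-positive : ∀ {u} → u ≢ c → 0 < label u
  label-positive u≢c = lookup (positive (spoke u≢c)) (singleton-∈ (times-from-centre (spoke u≢c)))

  -- Walks and journeys in the star.

  adj-centre : ∀ {u v} → u ≢ c → Adj u v → v ≡ c
  adj-centre u≢c e with incident e
  ... | inj₁ u≡c = contradiction u≡c u≢c
  ... | inj₂ v≡c = v≡c

  adj-leaf : ∀ {u} → Adj c u → u ≢ c
  adj-leaf e refl = irrefl refl e

  -- Traversing the edge cw in both directions would need two distinct labels on it.
  timeSteps-from-centre : ∀ {u} (p : TimedWalk Λ c u) → u ≢ c →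
                          Linked _<_ (timeSteps Λ p) → timeSteps Λ p ≡ [ label u ]
  timeSteps-from-centre stop u≢c _ = contradiction refl u≢c
  timeSteps-from-centre (step e t t∈ stop) _ _
    = cong [_] (∈-singleton (times-from-centre e) t∈)
  timeSteps-from-centre (step e t t∈ (step e′ t′ t′∈ p)) _ (t<t′ ∷ _)
    with refl ← adj-centre (adj-leaf e) e′
    = contradiction t<t′ (<-irrefl (trans (∈-singleton (times-from-centre e) t∈)
                                          (sym (∈-singleton (times-to-centre e′) t′∈))))

  -- From a leaf `s` the first edge enters the centre at time `label s`, and what remains is the
  -- single edge to `u`. From the centre there is only that edge.
  walk-to-leaf : ∀ {s u} (p : TimedWalk Λ s u) → s ≢ u → u ≢ c →
                 Linked _<_ (timeSteps Λ p) →
                 label s < label u × last (timeSteps Λ p) ≡ just (label u)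
  walk-to-leaf stop s≢u _ _ = contradiction refl s≢u
  walk-to-leaf {s} {u} p@(step e t t∈ q) s≢u u≢c inc with s ≟ c
  ... | yes refl = subst (_< label u) (sym label-centre) (label-positive u≢c) ,
                   cong last (timeSteps-from-centre p u≢c inc)
  ... | no  s≢c with refl ← adj-centre s≢c e
                with t<lu , last≡lu ← linked-last (timeSteps-from-centre q u≢c (tail inc)) inc
    = subst (_< label u) (∈-singleton (times-to-centre e) t∈) t<lu , last≡lu

  label-< : ∀ {s u} → s ≢ u → u ≢ c → Journey Λ s u → label s < label u
  label-< s≢u u≢c J = proj₁ (walk-to-leaf (walk J) s≢u u≢c (increasing J))

  arrival≡label : ∀ {s u} → s ≢ u → u ≢ c → (J : Journey Λ s u) → arrival Λ J ≡ label u
  arrival≡label s≢u u≢c J =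
    cong (fromMaybe 0) (proj₂ (walk-to-leaf (walk J) s≢u u≢c (increasing J)))

  stay : ∀ u → Journey Λ u u
  stay u = record { walk = stop ; isPath = [] ∷ [] ; increasing = [] }

  journey-from-centre : ∀ u → Journey Λ c u
  journey-from-centre u with u ≟ c
  ... | yes refl = stay c
  ... | no  u≢c  = record
    { walk       = step (spoke u≢c) (label u) (singleton-∈ (times-from-centre (spoke u≢c))) stop
    ; isPath     = (≢-sym u≢c ∷ []) ∷ [] ∷ []
    ; increasing = [-]
    }

  journey-to-leaf : ∀ {s u} → s ≢ u → u ≢ c → label s < label u → Journey Λ s u
  journey-to-leaf {s} {u} s≢u u≢c ls<lu with s ≟ c
  ... | yes refl = journey-from-centre u
  ... | no  s≢c  = record
    { walk       = step (adj-sym (spoke s≢c)) (label s) (singleton-∈ (times-to-centre (adj-sym (spoke s≢c))))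
                  (step (spoke u≢c) (label u) (singleton-∈ (times-from-centre (spoke u≢c))) stop)
    ; isPath     = (s≢c ∷ s≢u ∷ []) ∷ (≢-sym u≢c ∷ []) ∷ [] ∷ []
    ; increasing = ls<lu ∷ [-]
    }

  -- Temporal distances and resolved pairs.

  dist-self : ∀ u → IsDist Λ u u (just 0)
  dist-self u = finite (stay u) refl (λ _ → z≤n)

  -- All journeys from `s` to `u` arrive at the same time, so any one of them attains the minimum.
  dist-reachable : ∀ {s u} → s ≢ u → u ≢ c → Journey Λ s u → IsDist Λ s u (just (label u))
  dist-reachable s≢u u≢c J =
    finite J (arrival≡label s≢u u≢c J) (≤-reflexive ∘ sym ∘ arrival≡label s≢u u≢c)

  dist-from-centre : ∀ {u} → u ≢ c → IsDist Λ c u (just (label u))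
  dist-from-centre {u} u≢c = dist-reachable (≢-sym u≢c) u≢c (journey-from-centre u)

  -- `Resolves` asks for explicit distances, so reachability must be decided; comparing the labels
  -- does this.
  dist-to-leaf : ∀ {s u} → s ≢ u → u ≢ c → ∃[ d ] (IsDist Λ s u d × just 0 ≢ d)
  dist-to-leaf {s} {u} s≢u u≢c with label s <? label u
  ... | yes ls<lu = just (label u) , dist-reachable s≢u u≢c (journey-to-leaf s≢u u≢c ls<lu) ,
                    <⇒≢ (label-positive u≢c) ∘ just-injective
  ... | no  ls≮lu = nothing , infinite (ls≮lu ∘ label-< s≢u u≢c) , λ ()

  resolves-self : ∀ {u v} → u ≢ v → v ≢ c → Resolves Λ u u v
  resolves-self {u} u≢v v≢c with d , isDist , 0≢d ← dist-to-leaf u≢v v≢c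
    = just 0 , d , dist-self u , isDist , 0≢d

  resolves-sym : ∀ {s u v} → Resolves Λ s u v → Resolves Λ s v u
  resolves-sym (d , d′ , isDist , isDist′ , d≢d′) = d′ , d , isDist′ , isDist , ≢-sym d≢d′

  centre-resolves : ∀ {u v} → u ≢ c → v ≢ c → label u ≢ label v → Resolves Λ c u v
  centre-resolves {u} {v} u≢c v≢c lu≢lv =
    _ , _ , dist-from-centre u≢c , dist-from-centre v≢c , lu≢lv ∘ just-injective

  -- For a source other than the two leaves, both reachability and arrival time depend on the target
  -- only through its label.
  equal-labels-unresolved : ∀ {s u v} → s ≢ u → s ≢ v → u ≢ c → v ≢ c → label u ≡ label v →
                            ¬ Resolves Λ s u v
  equal-labels-unresolved s≢u s≢v u≢c v≢c lu≡lv (_ , _ , finite J refl _ , finite J′ refl _ , d≢d′) =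
    d≢d′ (cong just (trans (arrival≡label s≢u u≢c J) (trans lu≡lv (sym (arrival≡label s≢v v≢c J′)))))
  equal-labels-unresolved s≢u s≢v u≢c v≢c lu≡lv (_ , _ , finite J _ _ , infinite ¬J′ , _) =
    ¬J′ (journey-to-leaf s≢v v≢c (subst (label _ <_) lu≡lv (label-< s≢u u≢c J)))
  equal-labels-unresolved s≢u s≢v u≢c v≢c lu≡lv (_ , _ , infinite ¬J , finite J′ _ _ , _) =
    ¬J (journey-to-leaf s≢u u≢c (subst (label _ <_) (sym lu≡lv) (label-< s≢v v≢c J′)))
  equal-labels-unresolved _ _ _ _ _ (_ , _ , infinite _ , infinite _ , d≢d′) = d≢d′ refl

  -- Upper bound: the complement of `X` is resolving.

  complement-resolving : ∀ {X} → IsDistinctlyLabelledLeafSet star Λ X →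
                         IsTemporalResolving Λ (∁ X)
  complement-resolving {X} X-distinct = record
    { reaches  = λ v → c , c∈∁X , journey-from-centre v
    ; resolves = resolves
    }
    where
    open IsDistinctlyLabelledLeafSet X-distinct

    c∈∁X : c ∈ ∁ X
    c∈∁X = x∉p⇒x∈∁p λ c∈X → leaf c∈X refl

    distinct-labels : ∀ {u v} → u ∈ X → v ∈ X → u ≢ v → label u ≢ label v
    distinct-labels u∈X v∈X u≢v lu≡lv = distinct u∈X v∈X u≢v
      (trans (times-from-centre (spoke (leaf u∈X)))
        (trans (cong [_] lu≡lv) (sym (times-from-centre (spoke (leaf v∈X))))))

    resolves : ∀ {u v} → u ≢ v → ∃[ s ] (s ∈ ∁ X × Resolves Λ s u v)
    -- A pair with a member outside `X` (such as the centre) is resolved by that member; a pair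
    -- inside `X` is left to the centre.
    resolves {u} {v} u≢v with u ≟ c | v ≟ c
    ... | yes refl | _        = c , c∈∁X , resolves-self u≢v (≢-sym u≢v)
    ... | no u≢c   | yes refl = c , c∈∁X , resolves-sym (resolves-self (≢-sym u≢v) u≢c)
    ... | no u≢c   | no v≢c with u ∈? X | v ∈? X
    ...   | no u∉X  | _       = u , x∉p⇒x∈∁p u∉X , resolves-self u≢v v≢c
    ...   | yes _   | no v∉X  = v , x∉p⇒x∈∁p v∉X , resolves-sym (resolves-self (≢-sym u≢v) u≢c)
    ...   | yes u∈X | yes v∈X = c , c∈∁X , centre-resolves u≢c v≢c (distinct-labels u∈X v∈X u≢v)

  -- Lower bound: resolving sets yield distinctly labelled leaves.

  complement-distinct : ∀ {R} → c ∈ R →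
                        (∀ {u v} → u ∉ R → v ∉ R → u ≢ c → v ≢ c → u ≢ v → label u ≢ label v) →
                        IsDistinctlyLabelledLeafSet star Λ (∁ R)
  complement-distinct {R} c∈R labels-distinct = record
    { leaf     = leaf
    ; distinct = λ u∈ v∈ u≢v eq →
        labels-distinct (x∈∁p⇒x∉p u∈) (x∈∁p⇒x∉p v∈) (leaf u∈) (leaf v∈) u≢v
          -- Equality of the time lists places `label u` in that of `v`, whose only entry is
          -- `label v`.
          (∈-singleton (times-from-centre (spoke (leaf v∈)))
            (subst (label _ ∈ˡ_) eq (singleton-∈ (times-from-centre (spoke (leaf u∈))))))
    }
    where
    leaf : ∀ {u} → u ∈ ∁ R → u ≢ c
    leaf u∈∁R refl = x∈∁p⇒x∉p u∈∁R c∈R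

  module _ {R : Subset n} (R-resolving : IsTemporalResolving Λ R) where
    open IsTemporalResolving R-resolving

    ∈∉⇒≢ : ∀ {s v} → s ∈ R → v ∉ R → s ≢ v
    ∈∉⇒≢ s∈R v∉R refl = v∉R s∈R

    -- The resolving vertex lies in `R`, hence differs from both leaves and could not separate equal
    -- labels.
    labels-distinct-outside : ∀ {u v} → u ∉ R → v ∉ R → u ≢ c → v ≢ c → u ≢ v → label u ≢ label v
    labels-distinct-outside u∉R v∉R u≢c v≢c u≢v lu≡lv with s , s∈R , res ← resolves u≢v
      = equal-labels-unresolved (∈∉⇒≢ s∈R u∉R) (∈∉⇒≢ s∈R v∉R) u≢c v≢c lu≡lv res

    -- The only vertex that the exchange can newly expose is `s`, whose label is strictly below
    -- those of the leaves outside `R`.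
    exchange-distinct : ∀ {s} → (∀ {r} → r ∈ R → label s ≤ label r) →
                        IsDistinctlyLabelledLeafSet star Λ (∁ (exchange R s c))
    exchange-distinct {s} s-min = complement-distinct (x∈p∪q⁺ (inj₂ (x∈⁅x⁆ c))) labels-distinct
      where
      s-below : ∀ {v} → v ∉ R → v ≢ c → label s < label v
      s-below {v} v∉R v≢c with r , r∈R , J ← reaches v
        = ≤-<-trans (s-min r∈R) (label-< (∈∉⇒≢ r∈R v∉R) v≢c J)

      labels-distinct : ∀ {u v} → u ∉ exchange R s c → v ∉ exchange R s c →
                        u ≢ c → v ≢ c → u ≢ v → label u ≢ label v
      labels-distinct u∉ v∉ u≢c v≢c u≢v lu≡lv with ∉exchange R u∉ | ∉exchange R v∉
      ... | inj₁ refl | inj₁ refl = u≢v refl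
      ... | inj₁ refl | inj₂ v∉R  = <-irrefl lu≡lv (s-below v∉R v≢c)
      ... | inj₂ u∉R  | inj₁ refl = <-irrefl (sym lu≡lv) (s-below u∉R u≢c)
      ... | inj₂ u∉R  | inj₂ v∉R  = labels-distinct-outside u∉R v∉R u≢c v≢c u≢v lu≡lv

    resolving-lower-bound : ∀ {X} → IsMaximumSize (IsDistinctlyLabelledLeafSet star Λ) X →
                            ∣ ∁ X ∣ ≤ ∣ R ∣
    resolving-lower-bound {X} (_ , maximum) with c ∈? R
    ... | yes c∈R = ∣∁p∣≤∣q∣⇒∣∁q∣≤∣p∣ R X
                      (maximum (∁ R) (complement-distinct c∈R labels-distinct-outside))
    -- Reachability of `c` supplies an element of `R`, so a vertex of minimum label exists.
    ... | no _ with r , r∈R , _ ← reaches c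
               with s , s∈R , s-min ← minimiser label R r∈R
      = ≤-trans (∣∁p∣≤∣q∣⇒∣∁q∣≤∣p∣ (exchange R s c) X (maximum _ (exchange-distinct s-min)))
                (∣exchange∣≤ R c s∈R)

theorem8 : ∀ {n : ℕ} (S : Graph n) (c : Fin n) (star : IsStar S c)
    (Λ : TimeLabeling S) → IsOneLabeling Λ →
    (X : Subset n) →
    IsMaximumSize (IsDistinctlyLabelledLeafSet star Λ) X →
    IsMinimumSize (IsTemporalResolving Λ) (∁ X)
theorem8 S c star Λ oneLabeling X X-max =
  complement-resolving (proj₁ X-max) , λ R R-resolving → resolving-lower-bound R-resolving X-max
  where open OneLabelledStar star Λ oneLabeling
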